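{- Let $m_{p/q}$ denote the Markov number indexed by the reduced fraction $p/q\in(0,1)$ (as described in the context). Then: (1) (Fixed numerator) For all positive integers $p,q,i$ with $p<q$, $\gcd(q,p)=1$ and $\gcd(q+i,p)=1$, we have $m_{p/q}<m_{p/(q+i)}$. (2) (Fixed denominator) For all positive integers $p,q,i$ with $p+i<q$, $\gcd(q,p)=1$ and $\gcd(q,p+i)=1$, we have $m_{p/q}<m_{(p+i)/q}$.
   Context: A Markov number is any entry of a triple $(x,y,z)$ of positive integers satisfying $x^2+y^2+z^2=3xyz$. The Markov tree is the infinite binary tree with root $(1,5,2)$ in which a vertex $(x,y,z)$ has left child $(x,3xy-z,y)$ and right child $(y,3yz-x,z)$. The Farey tree is the binary tree with root $(\tfrac01,\tfrac12,\tfrac11)$ in which a vertex $(\tfrac ab,\tfrac{a+c}{b+d},\tfrac cd)$ has left child $(\tfrac ab,\tfrac{2a+c}{2b+d},\tfrac{a+c}{b+d})$ and right child $(\tfrac{a+c}{b+d},\tfrac{a+2c}{b+2d},\tfrac cd)$. The two trees have the same shape. Indexing: $m_{0/1}=1$, $m_{1/1}=2$, and for every vertex of the Farey tree, if its middle entry is the reduced fraction $p/q$, then $m_{p/q}$ is the middle entry of the vertex in the same position of the Markov tree (e.g. $m_{1/2}=5$, $m_{1/3}=13$, $m_{2/3}=29$). Every reduced fraction $p/q$ with $0<p<q$ occurs exactly once as a middle entry of the Farey tree. -}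

module Defs where

open import Data.Nat using (ℕ; _+_; _*_; _∸_)
open import Data.Bool using (Bool; true; false)
open import Data.List using (List; []; _∷_)
open import Data.Product using (_×_; _,_; Σ)
open import Relation.Binary.PropositionalEquality using (_≡_)

-- A position in an infinite binary tree: the list of moves from the root,
-- read from the head; false = go to the left child, true = go to the right child.
Path : Set
Path = List Bool

MTriple : Set
MTriple = ℕ × ℕ × ℕ

markovRoot : MTriple
markovRoot = 1 , 5 , 2

markovChild : Bool → MTriple → MTriple
markovChild false (x , y , z) = x , 3 * x * y ∸ z , y
markovChild true  (x , y , z) = y , 3 * y * z ∸ x , z

markovAt : MTriple → Path → MTriple
markovAt t []       = t
markovAt t (b ∷ bs) = markovAt (markovChild b t) bs

markovMid : Path → ℕ
markovMid s with markovAt markovRoot s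
... | (_ , y , _) = y

-- Farey tree vertices (a/b , (a+c)/(b+d) , c/d), stored as (a , b , c , d).
FTriple : Set
FTriple = ℕ × ℕ × ℕ × ℕ

fareyRoot : FTriple
fareyRoot = 0 , 1 , 1 , 1

fareyChild : Bool → FTriple → FTriple
fareyChild false (a , b , c , d) = a , b , a + c , b + d
fareyChild true  (a , b , c , d) = a + c , b + d , c , d

fareyAt : FTriple → Path → FTriple
fareyAt t []       = t
fareyAt t (b ∷ bs) = fareyAt (fareyChild b t) bs

fareyMid : Path → ℕ × ℕ
fareyMid s with fareyAt fareyRoot s
... | (a , b , c , d) = a + c , b + d

IsMarkovIndex : ℕ → ℕ → ℕ → Set
IsMarkovIndex p q m = Σ Path (λ s → fareyMid s ≡ (p , q) × markovMid s ≡ m)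

{-# OPTIONS --safe #-}

-- With a = (2 1; 1 1) and b = (5 2; 2 1), the Markov number m_{p/q} is one third of the trace of the Christoffel
-- word with q - p letters a and p letters b. The key fact is that this word has the least trace among all words
-- with the same numbers of letters. Indeed, if a cyclic word contains both aa and bb, it can be written f g with
-- f = a…b and g = b…a, and reversing f lowers the trace by -skew(f) skew(g) > 0. So one may assume that the minority
-- letter is isolated, and then rewrite the word in the pair (a, ab) or (ba, b), which is a move in the Farey tree; the
-- new pair again has a reversal of this kind. Both monotonicity claims follow: deleting letters a, or replacing letters
-- b by a, in the Christoffel word of the larger index lowers the trace and leaves a word with the letters of the
-- smaller index.

module Submission where

open import Defs
open import Data.Nat using (ℕ; _+_; _<_)
open import Data.Nat.GCD using (gcd)
open import Data.Product using (_×_)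
open import Relation.Binary.PropositionalEquality using (_≡_)

open import Data.Bool using (Bool; true; false; not)
open import Data.Bool.Properties using (not-involutive)
open import Data.Integer as ℤ using (ℤ; +_; ∣_∣)
open import Data.Integer.Tactic.RingSolver using (solve-∀)
open import Data.List using (List; []; _∷_; [_]; _++_; map; reverse)
open import Data.List.Properties using (++-assoc; map-++; unfold-reverse)
open import Data.List.Relation.Binary.Permutation.Propositional using (_↭_; prep; swap)
open import Data.List.Relation.Binary.Permutation.Propositional.Properties using (++-comm; ++⁺ʳ; ↭-reverse; shift)
open import Data.Nat using (zero; suc; _*_; _∸_; _≤_; z≤n; s≤s; z<s)
open import Data.Product using (∃; ∃₂; _,_; proj₁; proj₂)
open import Data.Sum using (_⊎_; inj₁; inj₂)
open import Relation.Binary.PropositionalEquality using (refl; sym; trans; cong; cong₂; subst; subst₂; module ≡-Reasoning)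
import Data.Integer.Properties as ℤₚ
import Data.Nat.Properties as ℕₚ
import Data.Nat.Tactic.RingSolver as ℕ-Ring

Word : Set
Word = List Bool

-- 2×2 integer matrices

record Mat : Set where
  no-eta-equality
  pattern
  constructor mat
  field
    e₁₁ e₁₂ e₂₁ e₂₂ : ℤ

open Mat

mat-cong : ∀ {a a′ b b′ c c′ d d′} → a ≡ a′ → b ≡ b′ → c ≡ c′ → d ≡ d′ → mat a b c d ≡ mat a′ b′ c′ d′
mat-cong refl refl refl refl = refl

infixl 7 _·_

_·_ : Mat → Mat → Mat
mat a b c d · mat e f g h =
  mat (a ℤ.* e ℤ.+ b ℤ.* g) (a ℤ.* f ℤ.+ b ℤ.* h) (c ℤ.* e ℤ.+ d ℤ.* g) (c ℤ.* f ℤ.+ d ℤ.* h)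

𝟙 : Mat
𝟙 = mat (+ 1) (+ 0) (+ 0) (+ 1)

infix 8 _ᵀ

_ᵀ : Mat → Mat
mat a b c d ᵀ = mat a c b d

adj : Mat → Mat
adj (mat a b c d) = mat d (ℤ.- b) (ℤ.- c) a

tr det skew : Mat → ℤ
tr   (mat a b c d) = a ℤ.+ d
det  (mat a b c d) = a ℤ.* d ℤ.- b ℤ.* c
skew (mat a b c d) = b ℤ.- c

·-assoc : ∀ X Y Z → (X · Y) · Z ≡ X · (Y · Z)
·-assoc (mat a b c d) (mat e f g h) (mat i j k l) =
  mat-cong (entry a b e f g h i k) (entry a b e f g h j l) (entry c d e f g h i k) (entry c d e f g h j l)
  where
  entry : ∀ a b e f g h i k →
    (a ℤ.* e ℤ.+ b ℤ.* g) ℤ.* i ℤ.+ (a ℤ.* f ℤ.+ b ℤ.* h) ℤ.* k ≡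
    a ℤ.* (e ℤ.* i ℤ.+ f ℤ.* k) ℤ.+ b ℤ.* (g ℤ.* i ℤ.+ h ℤ.* k)
  entry = solve-∀

·-identityˡ : ∀ X → 𝟙 · X ≡ X
·-identityˡ (mat a b c d) = mat-cong (top a c) (top b d) (bottom a c) (bottom b d)
  where
  top : ∀ x y → + 1 ℤ.* x ℤ.+ + 0 ℤ.* y ≡ x
  top = solve-∀
  bottom : ∀ x y → + 0 ℤ.* x ℤ.+ + 1 ℤ.* y ≡ y
  bottom = solve-∀

·-identityʳ : ∀ X → X · 𝟙 ≡ X
·-identityʳ (mat a b c d) = mat-cong (left a b) (right a b) (left c d) (right c d)
  where
  left : ∀ x y → x ℤ.* + 1 ℤ.+ y ℤ.* + 0 ≡ x
  left = solve-∀
  right : ∀ x y → x ℤ.* + 0 ℤ.+ y ℤ.* + 1 ≡ y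
  right = solve-∀

ᵀ-· : ∀ X Y → (X · Y) ᵀ ≡ Y ᵀ · X ᵀ
ᵀ-· (mat a b c d) (mat e f g h) = mat-cong (entry a e b g) (entry c e d g) (entry a f b h) (entry c f d h)
  where
  entry : ∀ a e b g → a ℤ.* e ℤ.+ b ℤ.* g ≡ e ℤ.* a ℤ.+ g ℤ.* b
  entry = solve-∀

tr-comm : ∀ X Y → tr (X · Y) ≡ tr (Y · X)
tr-comm (mat a b c d) (mat e f g h) = identity a b c d e f g h
  where
  identity : ∀ a b c d e f g h →
    (a ℤ.* e ℤ.+ b ℤ.* g) ℤ.+ (c ℤ.* f ℤ.+ d ℤ.* h) ≡ (e ℤ.* a ℤ.+ f ℤ.* c) ℤ.+ (g ℤ.* b ℤ.+ h ℤ.* d)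
  identity = solve-∀

det-· : ∀ X Y → det (X · Y) ≡ det X ℤ.* det Y
det-· (mat a b c d) (mat e f g h) = identity a b c d e f g h
  where
  identity : ∀ a b c d e f g h →
    (a ℤ.* e ℤ.+ b ℤ.* g) ℤ.* (c ℤ.* f ℤ.+ d ℤ.* h) ℤ.- (a ℤ.* f ℤ.+ b ℤ.* h) ℤ.* (c ℤ.* e ℤ.+ d ℤ.* g) ≡
    (a ℤ.* d ℤ.- b ℤ.* c) ℤ.* (e ℤ.* h ℤ.- f ℤ.* g)
  identity = solve-∀

det-·-1 : ∀ {X Y} → det X ≡ + 1 → det Y ≡ + 1 → det (X · Y) ≡ + 1
det-·-1 {X} {Y} p q = trans (det-· X Y) (cong₂ ℤ._*_ p q)

·-adj : ∀ X → det X ≡ + 1 → X · adj X ≡ 𝟙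
·-adj (mat a b c d) p = mat-cong (trans (e₁ a b c d) p) (e₂ a b) (e₃ c d) (trans (e₄ a b c d) p)
  where
  e₁ : ∀ a b c d → a ℤ.* d ℤ.+ b ℤ.* (ℤ.- c) ≡ a ℤ.* d ℤ.- b ℤ.* c
  e₁ = solve-∀
  e₂ : ∀ a b → a ℤ.* (ℤ.- b) ℤ.+ b ℤ.* a ≡ + 0
  e₂ = solve-∀
  e₃ : ∀ c d → c ℤ.* d ℤ.+ d ℤ.* (ℤ.- c) ≡ + 0
  e₃ = solve-∀
  e₄ : ∀ a b c d → c ℤ.* (ℤ.- b) ℤ.+ d ℤ.* a ≡ a ℤ.* d ℤ.- b ℤ.* c
  e₄ = solve-∀

-- N - Nᵀ is a multiple of the form J = (0 1; -1 0), and X J Xᵀ = det X · J.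
skew-congruence : ∀ X N → skew (X · N · X ᵀ) ≡ det X ℤ.* skew N
skew-congruence (mat a b c d) (mat e f g h) = identity a b c d e f g h
  where
  identity : ∀ a b c d e f g h →
    ((a ℤ.* e ℤ.+ b ℤ.* g) ℤ.* c ℤ.+ (a ℤ.* f ℤ.+ b ℤ.* h) ℤ.* d) ℤ.-
    ((c ℤ.* e ℤ.+ d ℤ.* g) ℤ.* a ℤ.+ (c ℤ.* f ℤ.+ d ℤ.* h) ℤ.* b) ≡
    (a ℤ.* d ℤ.- b ℤ.* c) ℤ.* (f ℤ.- g)
  identity = solve-∀

-- X² = tr X · X - 1, multiplied by `Y`. For the matrices below this becomes the Vieta involution on
-- Markov triples.
tr-cayley-hamilton : ∀ X Y → det X ≡ + 1 → tr (X · (X · Y)) ≡ tr X ℤ.* tr (X · Y) ℤ.- tr Y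
tr-cayley-hamilton X@(mat a b c d) Y@(mat e f g h) p =
  trans (identity a b c d e f g h) (cong (λ δ → tr X ℤ.* tr (X · Y) ℤ.- δ) (trans (cong (ℤ._* tr Y) p) (ℤₚ.*-identityˡ (tr Y))))
  where
  identity : ∀ a b c d e f g h →
    (a ℤ.* (a ℤ.* e ℤ.+ b ℤ.* g) ℤ.+ b ℤ.* (c ℤ.* e ℤ.+ d ℤ.* g)) ℤ.+
    (c ℤ.* (a ℤ.* f ℤ.+ b ℤ.* h) ℤ.+ d ℤ.* (c ℤ.* f ℤ.+ d ℤ.* h)) ≡
    (a ℤ.+ d) ℤ.* ((a ℤ.* e ℤ.+ b ℤ.* g) ℤ.+ (c ℤ.* f ℤ.+ d ℤ.* h)) ℤ.- (a ℤ.* d ℤ.- b ℤ.* c) ℤ.* (e ℤ.+ h)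
  identity = solve-∀

-- F′ = S Fᵀ S⁻¹ is F with its factors in the reverse order whenever every factor X satisfies X S = S Xᵀ.
tr-reversal : ∀ S F F′ G → det S ≡ + 1 → S ᵀ ≡ S → F′ · S ≡ S · F ᵀ →
  tr (F · G) ≡ tr (F′ · G) ℤ.+ ℤ.- (skew (F · S) ℤ.* skew (G · S))
tr-reversal S@(mat p q r s) F@(mat a b c d) F′ G@(mat e f g h) detS symS eq = begin
  tr (F · G)                                               ≡⟨ ℤₚ.*-identityˡ _ ⟨
  + 1 ℤ.* tr (F · G)                                       ≡⟨ cong (ℤ._* tr (F · G)) detS ⟨
  det S ℤ.* tr (F · G)                                     ≡⟨ polynomial (cong e₂₁ symS) ⟩
  tr (S · F ᵀ · adj S · G) ℤ.+ ℤ.- (skew (F · S) ℤ.* skew (G · S))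
    ≡⟨ cong (λ X → tr (X · G) ℤ.+ ℤ.- (skew (F · S) ℤ.* skew (G · S))) F′-eq ⟨
  tr (F′ · G) ℤ.+ ℤ.- (skew (F · S) ℤ.* skew (G · S))      ∎
  where
  open ≡-Reasoning
  F′-eq : F′ ≡ S · F ᵀ · adj S
  F′-eq = begin
    F′               ≡⟨ ·-identityʳ F′ ⟨
    F′ · 𝟙           ≡⟨ cong (F′ ·_) (·-adj S detS) ⟨
    F′ · (S · adj S) ≡⟨ ·-assoc F′ S (adj S) ⟨
    F′ · S · adj S   ≡⟨ cong (_· adj S) eq ⟩
    S · F ᵀ · adj S  ∎
  identity : ∀ p q s a b c d e f g h →
    (p ℤ.* s ℤ.- q ℤ.* q) ℤ.* ((a ℤ.* e ℤ.+ b ℤ.* g) ℤ.+ (c ℤ.* f ℤ.+ d ℤ.* h)) ≡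
    ((((p ℤ.* a ℤ.+ q ℤ.* b) ℤ.* s ℤ.+ (p ℤ.* c ℤ.+ q ℤ.* d) ℤ.* (ℤ.- q)) ℤ.* e ℤ.+
      ((p ℤ.* a ℤ.+ q ℤ.* b) ℤ.* (ℤ.- q) ℤ.+ (p ℤ.* c ℤ.+ q ℤ.* d) ℤ.* p) ℤ.* g) ℤ.+
     (((q ℤ.* a ℤ.+ s ℤ.* b) ℤ.* s ℤ.+ (q ℤ.* c ℤ.+ s ℤ.* d) ℤ.* (ℤ.- q)) ℤ.* f ℤ.+
      ((q ℤ.* a ℤ.+ s ℤ.* b) ℤ.* (ℤ.- q) ℤ.+ (q ℤ.* c ℤ.+ s ℤ.* d) ℤ.* p) ℤ.* h)) ℤ.+
    ℤ.- (((a ℤ.* q ℤ.+ b ℤ.* s) ℤ.- (c ℤ.* p ℤ.+ d ℤ.* q)) ℤ.*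
         ((e ℤ.* q ℤ.+ f ℤ.* s) ℤ.- (g ℤ.* p ℤ.+ h ℤ.* q)))
  identity = solve-∀
  -- Symmetry of `S` identifies its off-diagonal entries; what remains is a polynomial identity,
  -- with `det S` kept as a factor and `adj S` in place of the inverse.
  polynomial : q ≡ r →
    det S ℤ.* tr (F · G) ≡ tr (S · F ᵀ · adj S · G) ℤ.+ ℤ.- (skew (F · S) ℤ.* skew (G · S))
  polynomial refl = identity p q s a b c d e f g h

-- Words

ev : (Bool → Mat) → Word → Mat
ev M []      = 𝟙
ev M (x ∷ w) = M x · ev M w

ev-++ : ∀ M u v → ev M (u ++ v) ≡ ev M u · ev M v
ev-++ M []      v = sym (·-identityˡ _)
ev-++ M (x ∷ u) v = trans (cong (M x ·_) (ev-++ M u v)) (sym (·-assoc (M x) (ev M u) (ev M v)))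

ev-[] : ∀ M x → ev M [ x ] ≡ M x
ev-[] M x = ·-identityʳ (M x)

tr-ev-rotate : ∀ M u v → tr (ev M (u ++ v)) ≡ tr (ev M (v ++ u))
tr-ev-rotate M u v = begin
  tr (ev M (u ++ v))    ≡⟨ cong tr (ev-++ M u v) ⟩
  tr (ev M u · ev M v)  ≡⟨ tr-comm (ev M u) (ev M v) ⟩
  tr (ev M v · ev M u)  ≡⟨ cong tr (ev-++ M v u) ⟨
  tr (ev M (v ++ u))    ∎
  where open ≡-Reasoning

#a #b : Word → ℕ
#a []          = 0
#a (false ∷ w) = suc (#a w)
#a (true ∷ w)  = #a w
#b []          = 0
#b (false ∷ w) = #b w
#b (true ∷ w)  = suc (#b w)

infix 4 _∼_

-- Letter counts are compared directly, rather than through permutations, because equal counts can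
-- be cancelled through `σ`.
record _∼_ (u v : Word) : Set where
  constructor _&_
  field
    #a≡ : #a u ≡ #a v
    #b≡ : #b u ≡ #b v

open _∼_

∼-refl : ∀ {u} → u ∼ u
∼-refl = refl & refl

∼-trans : ∀ {u v w} → u ∼ v → v ∼ w → u ∼ w
∼-trans (p & q) (p′ & q′) = trans p p′ & trans q q′

∼-∷ : ∀ x {u v} → u ∼ v → x ∷ u ∼ x ∷ v
∼-∷ false (p & q) = cong suc p & q
∼-∷ true  (p & q) = p & cong suc q

∼-swap : ∀ x y w → x ∷ y ∷ w ∼ y ∷ x ∷ w
∼-swap false false w = refl & refl
∼-swap false true  w = refl & refl
∼-swap true  false w = refl & refl
∼-swap true  true  w = refl & refl

↭⇒∼ : ∀ {u v} → u ↭ v → u ∼ v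
↭⇒∼ _↭_.refl        = ∼-refl
↭⇒∼ (prep x p)      = ∼-∷ x (↭⇒∼ p)
↭⇒∼ (swap x y p)    = ∼-trans (∼-∷ x (∼-∷ y (↭⇒∼ p))) (∼-swap x y _)
↭⇒∼ (_↭_.trans p q) = ∼-trans (↭⇒∼ p) (↭⇒∼ q)

-- Exchange of the letters, and the substitution a ↦ a, b ↦ ab.

flip : Word → Word
flip = map not

#a-flip : ∀ w → #a (flip w) ≡ #b w
#a-flip []          = refl
#a-flip (false ∷ w) = #a-flip w
#a-flip (true ∷ w)  = cong suc (#a-flip w)

#b-flip : ∀ w → #b (flip w) ≡ #a w
#b-flip []          = refl
#b-flip (false ∷ w) = cong suc (#b-flip w)
#b-flip (true ∷ w)  = #b-flip w

-- The image consists of the words in which every b comes right after an a, that is, the words in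
-- the pair (a, ab).
σ : Word → Word
σ []          = []
σ (false ∷ w) = false ∷ σ w
σ (true ∷ w)  = false ∷ true ∷ σ w

#a-σ : ∀ w → #a (σ w) ≡ #a w + #b w
#a-σ []          = refl
#a-σ (false ∷ w) = cong suc (#a-σ w)
#a-σ (true ∷ w)  = trans (cong suc (#a-σ w)) (sym (ℕₚ.+-suc (#a w) (#b w)))

#b-σ : ∀ w → #b (σ w) ≡ #b w
#b-σ []          = refl
#b-σ (false ∷ w) = #b-σ w
#b-σ (true ∷ w)  = cong suc (#b-σ w)

∼-σ⁻¹ : ∀ u v → σ u ∼ σ v → u ∼ v
∼-σ⁻¹ u v (p & q) = ℕₚ.+-cancelʳ-≡ (#b u) (#a u) (#a v) (trans a-eq (cong (λ n → #a v + n) (sym b-eq))) & b-eq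
  where
  b-eq : #b u ≡ #b v
  b-eq = trans (sym (#b-σ u)) (trans q (#b-σ v))
  a-eq : #a u + #b u ≡ #a v + #b v
  a-eq = trans (sym (#a-σ u)) (trans p (#a-σ v))

-- Factors aa and bb of cyclic words.

find-aa : ∀ w → suc (#b w) < #a w → ∃₂ λ α β → w ≡ α ++ false ∷ false ∷ β
find-aa (true ∷ w) lt with find-aa w (ℕₚ.<-trans (ℕₚ.n<1+n _) lt)
... | α , β , eq = true ∷ α , β , cong (true ∷_) eq
find-aa (false ∷ []) (s≤s ())
find-aa (false ∷ false ∷ w) lt = [] , w , refl
-- Dropping a leading ab removes one letter of each kind, so the surplus of a persists.
find-aa (false ∷ true ∷ w) (s≤s lt) with find-aa w lt
... | α , β , eq = false ∷ true ∷ α , β , cong (λ v → false ∷ true ∷ v) eq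

data Majority : Word → Set where
  inside : ∀ α β → Majority (α ++ false ∷ false ∷ β)
  around : ∀ z → Majority (false ∷ z ++ [ false ])
  single : Majority [ false ]

-- Pigeonhole on a circle: fewer letters b cannot separate all the letters a, so two of these are
-- adjacent, inside the word or across its ends. The one-letter word a is the exception.
majority : ∀ w → #b w < #a w → Majority w
-- A leading b bars an aa across the ends, but the rest then has a surplus of at least two, enough
-- for a linear word.
majority (true ∷ w) lt with find-aa w lt
... | α , β , refl = inside (true ∷ α) β
majority (false ∷ []) lt = single
majority (false ∷ false ∷ w) lt = inside [] w
majority (false ∷ true ∷ w) (s≤s lt) with majority w lt
... | inside α β = inside (false ∷ true ∷ α) β
... | around z   = around (true ∷ false ∷ z)
... | single     = around [ true ]

-- Reading from the left, every b is preceded by an a until the first bb. Without bb the word cuts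
-- into blocks a and ab; otherwise it is cut in the middle of bb.
parse : ∀ z → (∃ λ u → false ∷ z ++ [ false ] ≡ σ u) ⊎
  (∃₂ λ x y → false ∷ z ++ [ false ] ≡ (false ∷ x ++ [ true ]) ++ (true ∷ y ++ [ false ]))
parse [] = inj₁ (false ∷ false ∷ [] , refl)
parse (false ∷ z) with parse z
... | inj₁ (u , eq)     = inj₁ (false ∷ u , cong (false ∷_) eq)
... | inj₂ (x , y , eq) = inj₂ (false ∷ x , y , cong (false ∷_) eq)
parse (true ∷ []) = inj₁ (true ∷ false ∷ [] , refl)
parse (true ∷ true ∷ z) = inj₂ ([] , z , refl)
parse (true ∷ false ∷ z) with parse z
... | inj₁ (u , eq)     = inj₁ (true ∷ u , cong (λ v → false ∷ true ∷ v) eq)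
... | inj₂ (x , y , eq) = inj₂ (true ∷ false ∷ x , y , cong (λ v → false ∷ true ∷ v) eq)

-- Only two properties of the trace enter: invariance under rotation, and the strict drop when f =
-- a...b is reversed in front of g = b...a.
module Smoothing
  (t : Word → ℕ)
  (rotate : ∀ u v → t (u ++ v) ≡ t (v ++ u))
  (decrease : ∀ x y → t (reverse (false ∷ x ++ [ true ]) ++ (true ∷ y ++ [ false ])) <
                      t ((false ∷ x ++ [ true ]) ++ (true ∷ y ++ [ false ])))
  where

  Smoothed : Word → Set
  Smoothed w = ∃ λ u → σ u ∼ w × t (σ u) ≤ t w

  weaken : ∀ {v w} → v ∼ w → t v ≤ t w → Smoothed v → Smoothed w
  weaken v∼w le (u , u∼v , le′) = u , ∼-trans u∼v v∼w , ℕₚ.≤-trans le′ le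

  -- Descent on `t`, with `n` a strict bound on its value: a reversal lowers `t` and uses up one
  -- unit of `n`, while a rotation costs nothing.
  smooth-below : ∀ n w → #b w < #a w → t w < n → Smoothed w
  smooth-around : ∀ n z → #b (false ∷ z ++ [ false ]) < #a (false ∷ z ++ [ false ]) →
    t (false ∷ z ++ [ false ]) < n → Smoothed (false ∷ z ++ [ false ])

  smooth-below n w lt tw<n with majority w lt
  ... | single   = [ false ] , ∼-refl , ℕₚ.≤-refl
  ... | around z = smooth-around n z lt tw<n
  -- Rotation carries the two letters of this aa to the two ends of the word.
  ... | inside α β = weaken v∼w (ℕₚ.≤-reflexive tv≡tw)
      (smooth-around n (β ++ α) (subst₂ _<_ (sym (#b≡ v∼w)) (sym (#a≡ v∼w)) lt) (subst (_< n) (sym tv≡tw) tw<n))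
    where
    v≡ : (false ∷ β) ++ (α ++ [ false ]) ≡ false ∷ (β ++ α) ++ [ false ]
    v≡ = cong (false ∷_) (sym (++-assoc β α [ false ]))
    w≡ : (α ++ [ false ]) ++ (false ∷ β) ≡ α ++ false ∷ false ∷ β
    w≡ = ++-assoc α [ false ] (false ∷ β)
    tv≡tw : t (false ∷ (β ++ α) ++ [ false ]) ≡ t (α ++ false ∷ false ∷ β)
    tv≡tw = trans (cong t (sym v≡)) (trans (rotate (false ∷ β) (α ++ [ false ])) (cong t w≡))
    v∼w : false ∷ (β ++ α) ++ [ false ] ∼ α ++ false ∷ false ∷ β
    v∼w = subst₂ _∼_ v≡ w≡ (↭⇒∼ (++-comm (false ∷ β) (α ++ [ false ])))

  smooth-around (suc n) z lt tw<n with parse z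
  ... | inj₁ (u , eq) = u , subst (_∼ (false ∷ z ++ [ false ])) eq ∼-refl , ℕₚ.≤-reflexive (cong t (sym eq))
  ... | inj₂ (x , y , eq) = weaken v∼w (ℕₚ.<⇒≤ tv<tw)
      (smooth-below n v (subst₂ _<_ (sym (#b≡ v∼w)) (sym (#a≡ v∼w)) lt) (ℕₚ.<-≤-trans tv<tw (ℕₚ.≤-pred tw<n)))
    where
    f g v : Word
    f = false ∷ x ++ [ true ]
    g = true ∷ y ++ [ false ]
    v = reverse f ++ g
    tv<tw : t v < t (false ∷ z ++ [ false ])
    tv<tw = subst (λ w → t v < t w) (sym eq) (decrease x y)
    v∼w : v ∼ false ∷ z ++ [ false ]
    v∼w = subst (v ∼_) (sym eq) (↭⇒∼ (++⁺ʳ g (↭-reverse f)))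

  smooth : ∀ w → #b w < #a w → Smoothed w
  smooth w lt = smooth-below (suc (t w)) w lt (ℕₚ.n<1+n (t w))

-- Pairs of matrices closed under reversal

-- S plays the role of the identity for a pair of symmetric matrices: X ↦ S Xᵀ S⁻¹ fixes both generators,
-- so it reverses words, and skew (X · S) measures how far X is from its own reversal.

record Reversible (M : Bool → Mat) : Set where
  field
    S         : Mat
    det-S     : det S ≡ + 1
    S-sym     : S ᵀ ≡ S
    det-M     : ∀ l → det (M l) ≡ + 1
    reverses  : ∀ l → M l · S ≡ S · M l ᵀ
    opposite  : ∀ x y → skew (ev M (false ∷ x ++ [ true ]) · S) ℤ.* skew (ev M (true ∷ y ++ [ false ]) · S) ℤ.< + 0
    tr-nonneg : ∀ w → + 0 ℤ.≤ tr (ev M w)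

∣∣-mono-< : ∀ {i j} → + 0 ℤ.≤ i → i ℤ.< j → ∣ i ∣ < ∣ j ∣
∣∣-mono-< (ℤ.+≤+ _) (ℤ.+<+ p) = p

trℕ : (Bool → Mat) → Word → ℕ
trℕ M w = ∣ tr (ev M w) ∣

trℕ-rotate : ∀ M u v → trℕ M (u ++ v) ≡ trℕ M (v ++ u)
trℕ-rotate M u v = cong ∣_∣ (tr-ev-rotate M u v)

module _ {M : Bool → Mat} (R : Reversible M) where
  open Reversible R

  -- `S` moves to the left past the letters, transposing each one.
  ev-reverse : ∀ w → ev M (reverse w) · S ≡ S · ev M w ᵀ
  ev-reverse [] = trans (·-identityˡ S) (sym (·-identityʳ S))
  ev-reverse (x ∷ w) = begin
    ev M (reverse (x ∷ w)) · S        ≡⟨ cong (λ v → ev M v · S) (unfold-reverse x w) ⟩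
    ev M (reverse w ++ [ x ]) · S     ≡⟨ cong (_· S) (ev-++ M (reverse w) [ x ]) ⟩
    ev M (reverse w) · ev M [ x ] · S ≡⟨ cong (λ X → ev M (reverse w) · X · S) (ev-[] M x) ⟩
    ev M (reverse w) · M x · S        ≡⟨ ·-assoc (ev M (reverse w)) (M x) S ⟩
    ev M (reverse w) · (M x · S)      ≡⟨ cong (ev M (reverse w) ·_) (reverses x) ⟩
    ev M (reverse w) · (S · M x ᵀ)    ≡⟨ ·-assoc (ev M (reverse w)) S (M x ᵀ) ⟨
    ev M (reverse w) · S · M x ᵀ      ≡⟨ cong (_· M x ᵀ) (ev-reverse w) ⟩
    S · ev M w ᵀ · M x ᵀ              ≡⟨ ·-assoc S (ev M w ᵀ) (M x ᵀ) ⟩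
    S · (ev M w ᵀ · M x ᵀ)            ≡⟨ cong (S ·_) (ᵀ-· (M x) (ev M w)) ⟨
    S · (M x · ev M w) ᵀ              ∎
    where open ≡-Reasoning

  -- By `opposite`, the correction term in `tr-reversal` is positive; `tr-nonneg` carries the
  -- inequality over to absolute values.
  tr-reverse-factor : ∀ x y → let f = false ∷ x ++ [ true ]; g = true ∷ y ++ [ false ] in
    trℕ M (reverse f ++ g) < trℕ M (f ++ g)
  tr-reverse-factor x y = ∣∣-mono-< (tr-nonneg (reverse f ++ g)) (subst₂ ℤ._<_ (cong tr (sym (ev-++ M (reverse f) g))) (sym eq) lt)
    where
    f g : Word
    f = false ∷ x ++ [ true ]
    g = true ∷ y ++ [ false ]
    drop : ℤ
    drop = ℤ.- (skew (ev M f · S) ℤ.* skew (ev M g · S))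
    T : ℤ
    T = tr (ev M (reverse f) · ev M g)
    eq : tr (ev M (f ++ g)) ≡ T ℤ.+ drop
    eq = trans (cong tr (ev-++ M f g))
      (tr-reversal S (ev M f) (ev M (reverse f)) (ev M g) det-S S-sym (ev-reverse f))
    lt : T ℤ.< T ℤ.+ drop
    lt = subst (ℤ._< T ℤ.+ drop) (ℤₚ.+-identityʳ T) (ℤₚ.+-monoʳ-< T (ℤₚ.neg-mono-< (opposite x y)))

  smooth : ∀ w → #b w < #a w → ∃ λ u → σ u ∼ w × trℕ M (σ u) ≤ trℕ M w
  smooth = Smoothing.smooth (trℕ M) (trℕ-rotate M) tr-reverse-factor

-- Moves of the Farey tree on pairs of matrices.

leftPair swapPair : (Bool → Mat) → Bool → Mat
leftPair M false = M false
leftPair M true  = M false · M true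
swapPair M l = M (not l)

ev-leftPair : ∀ M w → ev (leftPair M) w ≡ ev M (σ w)
ev-leftPair M []          = refl
ev-leftPair M (false ∷ w) = cong (M false ·_) (ev-leftPair M w)
ev-leftPair M (true ∷ w)  =
  trans (cong (M false · M true ·_) (ev-leftPair M w)) (·-assoc (M false) (M true) (ev M (σ w)))

ev-swapPair : ∀ M w → ev (swapPair M) w ≡ ev M (flip w)
ev-swapPair M []      = refl
ev-swapPair M (x ∷ w) = cong (M (not x) ·_) (ev-swapPair M w)

flip-involutive : ∀ w → flip (flip w) ≡ w
flip-involutive []      = refl
flip-involutive (x ∷ w) = cong₂ _∷_ (not-involutive x) (flip-involutive w)

swapPair-reversible : ∀ {M} → Reversible M → Reversible (swapPair M)
swapPair-reversible {M} R = record
  { S         = S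
  ; det-S     = det-S
  ; S-sym     = S-sym
  ; det-M     = λ l → det-M (not l)
  ; reverses  = λ l → reverses (not l)
  -- Flipping turns a...b into b...a and conversely, so the two factors change places.
  ; opposite  = λ x y → subst (ℤ._< + 0)
      (trans (ℤₚ.*-comm (skew (ev M (false ∷ flip y ++ [ true ]) · S)) (skew (ev M (true ∷ flip x ++ [ false ]) · S)))
        (cong₂ (λ X Y → skew (X · S) ℤ.* skew (Y · S)) (swapped false x true) (swapped true y false)))
      (opposite (flip y) (flip x))
  ; tr-nonneg = λ w → subst (λ X → + 0 ℤ.≤ tr X) (sym (ev-swapPair M w)) (tr-nonneg (flip w))
  }
  where
  open Reversible R
  swapped : ∀ k x l → ev M (not k ∷ flip x ++ [ not l ]) ≡ ev (swapPair M) (k ∷ x ++ [ l ])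
  swapped k x l = trans (cong (λ v → ev M (not k ∷ v)) (sym (map-++ not x [ l ]))) (sym (ev-swapPair M (k ∷ x ++ [ l ])))

-- The substitution a ↦ a, b ↦ ba, conjugate to `σ`: σ(w) a = a τ(w).
τ : Word → Word
τ []          = []
τ (false ∷ w) = false ∷ τ w
τ (true ∷ w)  = true ∷ false ∷ τ w

σ-snoc-false : ∀ w → σ (w ++ [ false ]) ≡ σ w ++ [ false ]
σ-snoc-false []          = refl
σ-snoc-false (false ∷ w) = cong (false ∷_) (σ-snoc-false w)
σ-snoc-false (true ∷ w)  = cong (λ v → false ∷ true ∷ v) (σ-snoc-false w)

σ-snoc-true : ∀ w → σ (w ++ [ true ]) ≡ false ∷ τ w ++ [ true ]
σ-snoc-true []          = refl
σ-snoc-true (false ∷ w) = cong (false ∷_) (σ-snoc-true w)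
σ-snoc-true (true ∷ w)  = cong (λ v → false ∷ true ∷ v) (σ-snoc-true w)

-- The new symmetrizer is A S, because A² S = A S Aᵀ and A B A S = A (B S) Aᵀ.
leftPair-reversible : ∀ {M} → Reversible M → Reversible (leftPair M)
leftPair-reversible {M} R = record
  { S         = A · S
  ; det-S     = det-·-1 {A} {S} (det-M false) det-S
  ; S-sym     = begin
      (A · S) ᵀ  ≡⟨ ᵀ-· A S ⟩
      S ᵀ · A ᵀ  ≡⟨ cong (_· A ᵀ) S-sym ⟩
      S · A ᵀ    ≡⟨ reverses false ⟨
      A · S      ∎
  ; det-M     = λ { false → det-M false ; true → det-·-1 {A} {B} (det-M false) (det-M true) }
  ; reverses  = λ { false → push A ; true → reverses-AB }
  -- Both images under `σ` start with an a. Without it, a x b becomes a τ(x) b and b y a becomes b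
  -- σ(y) a, words of the shapes covered by the old `opposite`.
  ; opposite  = λ x y → subst (ℤ._< + 0)
      (sym (cong₂ ℤ._*_
        (skew-step (false ∷ x ++ [ true ]) (cong (false ∷_) (σ-snoc-true x)))
        (skew-step (true ∷ y ++ [ false ]) (cong (λ v → false ∷ true ∷ v) (σ-snoc-false y)))))
      (opposite (τ x) (σ y))
  ; tr-nonneg = λ w → subst (λ X → + 0 ℤ.≤ tr X) (sym (ev-leftPair M w)) (tr-nonneg (σ w))
  }
  where
  open Reversible R
  open ≡-Reasoning
  A B : Mat
  A = M false
  B = M true
  push : ∀ X → X · (A · S) ≡ X · S · A ᵀ
  push X = trans (cong (X ·_) (reverses false)) (sym (·-assoc X S (A ᵀ)))
  reverses-AB : A · B · (A · S) ≡ A · S · (A · B) ᵀ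
  reverses-AB = begin
    A · B · (A · S)       ≡⟨ push (A · B) ⟩
    A · B · S · A ᵀ       ≡⟨ cong (_· A ᵀ) (·-assoc A B S) ⟩
    A · (B · S) · A ᵀ     ≡⟨ cong (λ X → A · X · A ᵀ) (reverses true) ⟩
    A · (S · B ᵀ) · A ᵀ   ≡⟨ cong (_· A ᵀ) (·-assoc A S (B ᵀ)) ⟨
    A · S · B ᵀ · A ᵀ     ≡⟨ ·-assoc (A · S) (B ᵀ) (A ᵀ) ⟩
    A · S · (B ᵀ · A ᵀ)   ≡⟨ cong (A · S ·_) (ᵀ-· A B) ⟨
    A · S · (A · B) ᵀ     ∎
  -- A V (A S) = A (V S) Aᵀ is a congruence by a matrix of determinant 1, so the leading `A` leaves
  -- no trace in `skew`.
  skew-step : ∀ w {v} → σ w ≡ false ∷ v → skew (ev (leftPair M) w · (A · S)) ≡ skew (ev M v · S)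
  skew-step w {v} eq = begin
    skew (ev (leftPair M) w · (A · S))  ≡⟨ cong (λ X → skew (X · (A · S))) (trans (ev-leftPair M w) (cong (ev M) eq)) ⟩
    skew (A · ev M v · (A · S))         ≡⟨ cong skew (push (A · ev M v)) ⟩
    skew (A · ev M v · S · A ᵀ)         ≡⟨ cong (λ X → skew (X · A ᵀ)) (·-assoc A (ev M v) S) ⟩
    skew (A · (ev M v · S) · A ᵀ)       ≡⟨ skew-congruence A (ev M v · S) ⟩
    det A ℤ.* skew (ev M v · S)         ≡⟨ cong (ℤ._* skew (ev M v · S)) (det-M false) ⟩
    + 1 ℤ.* skew (ev M v · S)           ≡⟨ ℤₚ.*-identityˡ _ ⟩
    skew (ev M v · S)                   ∎

-- The pair (ba, b), obtained from the left move by exchanging the letters before and after.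
rightPair : (Bool → Mat) → Bool → Mat
rightPair M = swapPair (leftPair (swapPair M))

rightPair-reversible : ∀ {M} → Reversible M → Reversible (rightPair M)
rightPair-reversible R = swapPair-reversible (leftPair-reversible (swapPair-reversible R))

-- Minimality of Christoffel words

-- The first move is the outermost substitution: the rest of the path spells a word in the new pair.
-- A right move is a ↦ ba, b ↦ b, so the result is a Christoffel word up to rotation, which the
-- trace does not see.
christoffel : Path → Word
christoffel []          = false ∷ true ∷ []
christoffel (false ∷ s) = σ (christoffel s)
christoffel (true ∷ s)  = flip (σ (flip (christoffel s)))

ev-rightPair : ∀ M w → ev (rightPair M) w ≡ ev M (flip (σ (flip w)))
ev-rightPair M w = begin
  ev (rightPair M) w                ≡⟨ ev-swapPair (leftPair (swapPair M)) w ⟩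
  ev (leftPair (swapPair M)) (flip w) ≡⟨ ev-leftPair (swapPair M) (flip w) ⟩
  ev (swapPair M) (σ (flip w))      ≡⟨ ev-swapPair M (σ (flip w)) ⟩
  ev M (flip (σ (flip w)))          ∎
  where open ≡-Reasoning

#a-right : ∀ w → #a (flip (σ (flip w))) ≡ #a w
#a-right w = trans (#a-flip (σ (flip w))) (trans (#b-σ (flip w)) (#b-flip w))

#b-right : ∀ w → #b (flip (σ (flip w))) ≡ #b w + #a w
#b-right w = trans (#b-flip (σ (flip w))) (trans (#a-σ (flip w)) (cong₂ _+_ (#a-flip w) (#b-flip w)))

christoffel-letters : ∀ s → 0 < #a (christoffel s) × 0 < #b (christoffel s)
christoffel-letters [] = ℕₚ.n<1+n 0 , ℕₚ.n<1+n 0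
christoffel-letters (false ∷ s) with christoffel-letters s
... | p , q = subst (0 <_) (sym (#a-σ (christoffel s))) (ℕₚ.<-≤-trans p (ℕₚ.m≤m+n _ _)) ,
              subst (0 <_) (sym (#b-σ (christoffel s))) q
christoffel-letters (true ∷ s) with christoffel-letters s
... | p , q = subst (0 <_) (sym (#a-right (christoffel s))) p ,
              subst (0 <_) (sym (#b-right (christoffel s))) (ℕₚ.<-≤-trans q (ℕₚ.m≤m+n _ _))

#b<#a-σ : ∀ w → 0 < #a w → #b (σ w) < #a (σ w)
#b<#a-σ w p = subst₂ _<_ (sym (#b-σ w)) (sym (#a-σ w)) (ℕₚ.m<n+m (#b w) p)

flip-∼ : ∀ {u v} → u ∼ v → flip u ∼ flip v
flip-∼ {u} {v} (p & q) = trans (#a-flip u) (trans q (sym (#a-flip v))) & trans (#b-flip u) (trans p (sym (#b-flip v)))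

-- A word with the letters of σ(v) has more a than b, so smoothing brings it to some σ(u), whose
-- trace is that of `u` in the left pair.
smooth-σ : ∀ {M} → Reversible M → ∀ v w → 0 < #a v → w ∼ σ v → ∃ λ u → u ∼ v × trℕ (leftPair M) u ≤ trℕ M w
smooth-σ {M} R v w p w∼σv with smooth R w (subst₂ _<_ (sym (#b≡ w∼σv)) (sym (#a≡ w∼σv)) (#b<#a-σ v p))
... | u , σu∼w , le =
  u , ∼-σ⁻¹ u v (∼-trans σu∼w w∼σv) , subst (λ X → ∣ tr X ∣ ≤ trℕ M w) (sym (ev-leftPair M u)) le

no-letters : ∀ w → #a w ≡ 0 → #b w ≡ 0 → w ≡ []
no-letters []          _  _  = refl
no-letters (false ∷ w) () _
no-letters (true ∷ w)  _  ()

one-letter-a : ∀ w → #a w ≡ 1 → #b w ≡ 0 → w ≡ [ false ]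
one-letter-a (false ∷ w) p q = cong (false ∷_) (no-letters w (ℕₚ.suc-injective p) q)

one-letter-b : ∀ w → #a w ≡ 0 → #b w ≡ 1 → w ≡ [ true ]
one-letter-b (true ∷ w) p q = cong (true ∷_) (no-letters w p (ℕₚ.suc-injective q))

-- Induction on the path, over all reversible pairs at once, since each move replaces the pair.
christoffel-minimal : ∀ s {M} → Reversible M → ∀ w → w ∼ christoffel s → trℕ M (christoffel s) ≤ trℕ M w
-- One a and one b spell either ab or its rotation ba.
christoffel-minimal [] R (false ∷ w) (p & q) with refl ← one-letter-b w (ℕₚ.suc-injective p) q = ℕₚ.≤-refl
christoffel-minimal [] {M} R (true ∷ w) (p & q) with refl ← one-letter-a w p (ℕₚ.suc-injective q) =
  ℕₚ.≤-reflexive (cong ∣_∣ (tr-ev-rotate M [ false ] [ true ]))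
christoffel-minimal (false ∷ s) {M} R w w∼ with smooth-σ R (christoffel s) w (proj₁ (christoffel-letters s)) w∼
... | u , u∼ , le = ℕₚ.≤-trans
  (subst (λ X → ∣ tr X ∣ ≤ trℕ (leftPair M) u) (ev-leftPair M (christoffel s))
    (christoffel-minimal s (leftPair-reversible R) u u∼)) le
-- In `flip w` the letter `false` has the majority, so the argument for the left move applies to the
-- swapped pair.
christoffel-minimal (true ∷ s) {M} R w w∼
  with smooth-σ (swapPair-reversible R) (flip c) (flip w) (subst (0 <_) (sym (#a-flip c)) (proj₂ (christoffel-letters s)))
         (subst (flip w ∼_) (flip-involutive (σ (flip c))) (flip-∼ w∼))
  where
  c : Word
  c = christoffel s
... | u , u∼ , le = begin
  trℕ M (christoffel (true ∷ s))             ≡⟨ cong (λ X → ∣ tr X ∣) (ev-rightPair M c) ⟨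
  trℕ (rightPair M) c                        ≤⟨ christoffel-minimal s (rightPair-reversible R) (flip u) flip-u∼ ⟩
  trℕ (rightPair M) (flip u)                 ≡⟨ cong (λ X → ∣ tr X ∣) (ev-swapPair (leftPair (swapPair M)) (flip u)) ⟩
  trℕ (leftPair (swapPair M)) (flip (flip u)) ≡⟨ cong (trℕ (leftPair (swapPair M))) (flip-involutive u) ⟩
  trℕ (leftPair (swapPair M)) u              ≤⟨ le ⟩
  trℕ (swapPair M) (flip w)                  ≡⟨ cong (λ X → ∣ tr X ∣) (ev-swapPair M (flip w)) ⟩
  trℕ M (flip (flip w))                      ≡⟨ cong (trℕ M) (flip-involutive w) ⟩
  trℕ M w                                    ∎
  where
  open ℕₚ.≤-Reasoning
  c : Word
  c = christoffel s
  flip-u∼ : flip u ∼ c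
  flip-u∼ = subst (flip u ∼_) (flip-involutive c) (flip-∼ u∼)

-- Markov numbers as traces

-- Cohn matrices of the Markov numbers 1 and 2, with traces 3 and 6; their product has trace 15 = 3
-- · 5.
cohn : Bool → Mat
cohn false = mat (+ 2) (+ 1) (+ 1) (+ 1)
cohn true  = mat (+ 5) (+ 2) (+ 2) (+ 1)

-- Strict on the diagonal only, so that the value `𝟙` of the empty word is included.
data Positive : Mat → Set where
  positive : ∀ {p q s t} → + 0 ℤ.< p → + 0 ℤ.≤ q → + 0 ℤ.≤ s → + 0 ℤ.< t → Positive (mat p q s t)

scale-≤ : ∀ k {i} → + 0 ℤ.≤ i → + 0 ℤ.≤ + k ℤ.* i
scale-≤ k {+ n} _ = subst (+ 0 ℤ.≤_) (ℤₚ.pos-* k n) (ℤ.+≤+ z≤n)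

scale-< : ∀ k {i} → + 0 ℤ.< i → + 0 ℤ.< + suc k ℤ.* i
scale-< k {+ suc n} _ = ℤ.+<+ z<s
scale-< k {+ zero} (ℤ.+<+ ())

cohn-positive : ∀ l {N} → Positive N → Positive (cohn l · N)
cohn-positive false (positive p q s t) = positive
  (ℤₚ.+-mono-<-≤ (scale-< 1 p) (scale-≤ 1 s))
  (ℤₚ.+-mono-≤ (scale-≤ 2 q) (scale-≤ 1 (ℤₚ.<⇒≤ t)))
  (ℤₚ.+-mono-≤ (scale-≤ 1 (ℤₚ.<⇒≤ p)) (scale-≤ 1 s))
  (ℤₚ.+-mono-≤-< (scale-≤ 1 q) (scale-< 0 t))
cohn-positive true (positive p q s t) = positive
  (ℤₚ.+-mono-<-≤ (scale-< 4 p) (scale-≤ 2 s))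
  (ℤₚ.+-mono-≤ (scale-≤ 5 q) (scale-≤ 2 (ℤₚ.<⇒≤ t)))
  (ℤₚ.+-mono-≤ (scale-≤ 2 (ℤₚ.<⇒≤ p)) (scale-≤ 1 s))
  (ℤₚ.+-mono-≤-< (scale-≤ 2 q) (scale-< 0 t))

ev-cohn-positive : ∀ w → Positive (ev cohn w)
ev-cohn-positive []      = positive (ℤ.+<+ z<s) (ℤ.+≤+ z≤n) (ℤ.+≤+ z≤n) (ℤ.+<+ z<s)
ev-cohn-positive (x ∷ w) = cohn-positive x (ev-cohn-positive w)

tr-positive : ∀ {N} → Positive N → + 0 ℤ.≤ tr N
tr-positive (positive p q s t) = ℤₚ.<⇒≤ (ℤₚ.+-mono-< p t)

-- The skew entry is -(p + 3s + t), so its sign is decided by the outer letters alone.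
skew-aNb : ∀ {N} → Positive N → skew (cohn false · (N · cohn true)) ℤ.< + 0
skew-aNb {mat p q s t} (positive p>0 q≥0 s≥0 t>0) = subst (ℤ._< + 0) (sym (identity p q s t))
  (ℤₚ.neg-mono-< (ℤₚ.+-mono-< (ℤₚ.+-mono-<-≤ p>0 (scale-≤ 3 s≥0)) t>0))
  where
  identity : ∀ p q s t →
    (+ 2 ℤ.* (p ℤ.* + 2 ℤ.+ q ℤ.* + 1) ℤ.+ + 1 ℤ.* (s ℤ.* + 2 ℤ.+ t ℤ.* + 1)) ℤ.-
    (+ 1 ℤ.* (p ℤ.* + 5 ℤ.+ q ℤ.* + 2) ℤ.+ + 1 ℤ.* (s ℤ.* + 5 ℤ.+ t ℤ.* + 2)) ≡
    ℤ.- (p ℤ.+ + 3 ℤ.* s ℤ.+ t)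
  identity = solve-∀

skew-bNa : ∀ {N} → Positive N → + 0 ℤ.< skew (cohn true · (N · cohn false))
skew-bNa {mat p q s t} (positive p>0 q≥0 s≥0 t>0) = subst (+ 0 ℤ.<_) (sym (identity p q s t))
  (ℤₚ.+-mono-< (ℤₚ.+-mono-<-≤ p>0 (scale-≤ 3 q≥0)) t>0)
  where
  identity : ∀ p q s t →
    (+ 5 ℤ.* (p ℤ.* + 1 ℤ.+ q ℤ.* + 1) ℤ.+ + 2 ℤ.* (s ℤ.* + 1 ℤ.+ t ℤ.* + 1)) ℤ.-
    (+ 2 ℤ.* (p ℤ.* + 2 ℤ.+ q ℤ.* + 1) ℤ.+ + 1 ℤ.* (s ℤ.* + 2 ℤ.+ t ℤ.* + 1)) ≡
    p ℤ.+ + 3 ℤ.* q ℤ.+ t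
  identity = solve-∀

neg*pos<0 : ∀ {i j} → i ℤ.< + 0 → + 0 ℤ.< j → i ℤ.* j ℤ.< + 0
neg*pos<0 {ℤ.-[1+ m ]} {+ suc n} _ _ = ℤ.-<+
neg*pos<0 {+ m} (ℤ.+<+ ()) _
neg*pos<0 {ℤ.-[1+ m ]} {+ zero} _ (ℤ.+<+ ())

ev-bracket : ∀ M k w l → ev M (k ∷ w ++ [ l ]) · 𝟙 ≡ M k · (ev M w · M l)
ev-bracket M k w l = trans (·-identityʳ _)
  (cong (M k ·_) (trans (ev-++ M w [ l ]) (cong (ev M w ·_) (ev-[] M l))))

-- Both matrices are symmetric, so plain transposition reverses words and `S` is the identity.
cohn-reversible : Reversible cohn
cohn-reversible = record
  { S         = 𝟙
  ; det-S     = refl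
  ; S-sym     = refl
  ; det-M     = λ { false → refl ; true → refl }
  ; reverses  = λ { false → refl ; true → refl }
  ; opposite  = λ x y → neg*pos<0
      (subst (λ X → skew X ℤ.< + 0) (sym (ev-bracket cohn false x true)) (skew-aNb (ev-cohn-positive x)))
      (subst (λ X → + 0 ℤ.< skew X) (sym (ev-bracket cohn true y false)) (skew-bNa (ev-cohn-positive y)))
  ; tr-nonneg = λ w → tr-positive (ev-cohn-positive w)
  }

mid : MTriple → ℕ
mid (_ , y , _) = y

-- As `i` is a nonnegative trace, the subtraction in the Markov tree is not truncated.
vieta : ∀ x y z {i} → + 0 ℤ.≤ i → i ≡ + (3 * x) ℤ.* + (3 * y) ℤ.- + (3 * z) → i ≡ + (3 * (3 * x * y ∸ z))
vieta x y z {i} 0≤i eq = begin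
  i                                       ≡⟨ eq ⟩
  + (3 * x) ℤ.* + (3 * y) ℤ.- + (3 * z)   ≡⟨ cong (ℤ._- + (3 * z)) product ⟩
  + (3 * (3 * x * y)) ℤ.- + (3 * z)       ≡⟨ ℤₚ.m-n≡m⊖n (3 * (3 * x * y)) (3 * z) ⟩
  3 * (3 * x * y) ℤ.⊖ 3 * z               ≡⟨ ℤₚ.⊖-≥ {3 * (3 * x * y)} {3 * z} (ℤₚ.drop‿+≤+ (ℤₚ.0≤i-j⇒j≤i 0≤)) ⟩
  + (3 * (3 * x * y) ∸ 3 * z)             ≡⟨ cong +_ (ℕₚ.*-distribˡ-∸ 3 (3 * x * y) z) ⟨
  + (3 * (3 * x * y ∸ z))                 ∎
  where
  open ≡-Reasoning
  rearrange : ∀ x y → 3 * x * (3 * y) ≡ 3 * (3 * x * y)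
  rearrange = ℕ-Ring.solve-∀
  product : + (3 * x) ℤ.* + (3 * y) ≡ + (3 * (3 * x * y))
  product = trans (sym (ℤₚ.pos-* (3 * x) (3 * y))) (cong +_ (rearrange x y))
  0≤ : + 0 ℤ.≤ + (3 * (3 * x * y)) ℤ.- + (3 * z)
  0≤ = subst (+ 0 ℤ.≤_) (trans eq (cong (ℤ._- + (3 * z)) product)) 0≤i

tr-pair : ∀ M → tr (ev M (false ∷ true ∷ [])) ≡ tr (M false · M true)
tr-pair M = cong (λ X → tr (M false · X)) (·-identityʳ (M true))

-- The traces of A, AB and B are three times a vertex of the Markov tree. A Farey move on the pair
-- takes this vertex to its child, by Cayley-Hamilton.
tr-markovAt : ∀ s {M} → Reversible M → ∀ x y z →
  tr (M false) ≡ + (3 * x) → tr (M false · M true) ≡ + (3 * y) → tr (M true) ≡ + (3 * z) →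
  tr (ev M (christoffel s)) ≡ + (3 * mid (markovAt (x , y , z) s))
tr-markovAt [] {M} R x y z p q r = trans (tr-pair M) q
tr-markovAt (false ∷ s) {M} R x y z p q r =
  trans (cong tr (sym (ev-leftPair M (christoffel s))))
    (tr-markovAt s R′ x (3 * x * y ∸ z) y p (vieta x y z nonneg eq) q)
  where
  R′ : Reversible (leftPair M)
  R′ = leftPair-reversible R
  nonneg : + 0 ℤ.≤ tr (M false · (M false · M true))
  nonneg = subst (+ 0 ℤ.≤_) (tr-pair (leftPair M)) (Reversible.tr-nonneg R′ (false ∷ true ∷ []))
  eq : tr (M false · (M false · M true)) ≡ + (3 * x) ℤ.* + (3 * y) ℤ.- + (3 * z)
  eq = trans (tr-cayley-hamilton (M false) (M true) (Reversible.det-M R false))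
    (cong₂ ℤ._-_ (cong₂ ℤ._*_ p q) r)
tr-markovAt (true ∷ s) {M} R x y z p q r =
  trans (cong tr (sym (ev-rightPair M (christoffel s))))
    (tr-markovAt s R′ y (3 * y * z ∸ x) z q′ (vieta y z x nonneg eq) r)
  where
  R′ : Reversible (rightPair M)
  R′ = rightPair-reversible R
  q′ : tr (M true · M false) ≡ + (3 * y)
  q′ = trans (tr-comm (M true) (M false)) q
  nonneg : + 0 ℤ.≤ tr (M true · M false · M true)
  nonneg = subst (+ 0 ℤ.≤_) (tr-pair (rightPair M)) (Reversible.tr-nonneg R′ (false ∷ true ∷ []))
  eq : tr (M true · M false · M true) ≡ + (3 * y) ℤ.* + (3 * z) ℤ.- + (3 * x)
  eq = begin
    tr (M true · M false · M true)                                    ≡⟨ tr-comm (M true · M false) (M true) ⟩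
    tr (M true · (M true · M false))
      ≡⟨ tr-cayley-hamilton (M true) (M false) (Reversible.det-M R true) ⟩
    tr (M true) ℤ.* tr (M true · M false) ℤ.- tr (M false)            ≡⟨ cong₂ ℤ._-_ (cong₂ ℤ._*_ r q′) p ⟩
    + (3 * z) ℤ.* + (3 * y) ℤ.- + (3 * x)
      ≡⟨ cong (ℤ._- + (3 * x)) (ℤₚ.*-comm (+ (3 * z)) (+ (3 * y))) ⟩
    + (3 * y) ℤ.* + (3 * z) ℤ.- + (3 * x)                             ∎
    where open ≡-Reasoning

trℕ-christoffel : ∀ s → trℕ cohn (christoffel s) ≡ 3 * markovMid s
trℕ-christoffel s = cong ∣_∣ (tr-markovAt s cohn-reversible 1 5 2 refl refl refl)

-- Letter counts and the Farey tree.

mediant : FTriple → ℕ × ℕ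
mediant (a , b , c , d) = a + c , b + d

-- Mediants add like letter counts: each a contributes the left parent (a, b) and each b the right
-- parent (c, d).
mediant-fareyAt : ∀ s a b c d → let w = christoffel s in
  mediant (fareyAt (a , b , c , d) s) ≡ (#a w * a + #b w * c , #a w * b + #b w * d)
mediant-fareyAt [] a b c d = cong₂ _,_ (unit a c) (unit b d)
  where
  unit : ∀ a c → a + c ≡ 1 * a + 1 * c
  unit = ℕ-Ring.solve-∀
mediant-fareyAt (false ∷ s) a b c d = trans (mediant-fareyAt s a b (a + c) (b + d)) (cong₂ _,_ (eq a c) (eq b d))
  where
  w : Word
  w = christoffel s
  regroup : ∀ m n a c → m * a + n * (a + c) ≡ (m + n) * a + n * c
  regroup = ℕ-Ring.solve-∀
  eq : ∀ a c → #a w * a + #b w * (a + c) ≡ #a (σ w) * a + #b (σ w) * c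
  eq a c = trans (regroup (#a w) (#b w) a c) (cong₂ (λ m n → m * a + n * c) (sym (#a-σ w)) (sym (#b-σ w)))
mediant-fareyAt (true ∷ s) a b c d = trans (mediant-fareyAt s (a + c) (b + d) c d) (cong₂ _,_ (eq a c) (eq b d))
  where
  w : Word
  w = christoffel s
  regroup : ∀ m n a c → m * (a + c) + n * c ≡ m * a + (n + m) * c
  regroup = ℕ-Ring.solve-∀
  eq : ∀ a c → #a w * (a + c) + #b w * c ≡ #a (flip (σ (flip w))) * a + #b (flip (σ (flip w))) * c
  eq a c = trans (regroup (#a w) (#b w) a c) (cong₂ (λ m n → m * a + n * c) (sym (#a-right w)) (sym (#b-right w)))

fareyMid-christoffel : ∀ s → let w = christoffel s in fareyMid s ≡ (#b w , #a w + #b w)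
fareyMid-christoffel s = trans (mediant-fareyAt s 0 1 1 1) (cong₂ _,_ (numerator (#a w) (#b w)) (denominator (#a w) (#b w)))
  where
  w : Word
  w = christoffel s
  numerator : ∀ m n → m * 0 + n * 1 ≡ n
  numerator = ℕ-Ring.solve-∀
  denominator : ∀ m n → m * 1 + n * 1 ≡ m + n
  denominator = ℕ-Ring.solve-∀

-- Comparison of Markov numbers

-- The word has q - p letters a; the count is given as a sum to avoid truncated subtraction.
christoffel-of : ∀ {p q m} → IsMarkovIndex p q m →
  ∃ λ s → #b (christoffel s) ≡ p × #a (christoffel s) + p ≡ q × trℕ cohn (christoffel s) ≡ 3 * m
christoffel-of {p} {q} (s , farey , refl) = s , b≡p , trans (cong (λ n → #a w + n) (sym b≡p)) (cong proj₂ eq) , trℕ-christoffel s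
  where
  w : Word
  w = christoffel s
  eq : (#b w , #a w + #b w) ≡ (p , q)
  eq = trans (sym (fareyMid-christoffel s)) farey
  b≡p : #b w ≡ p
  b≡p = cong proj₁ eq

i<i+j : ∀ i {j} → + 0 ℤ.< j → i ℤ.< i ℤ.+ j
i<i+j i {j} 0<j = subst (ℤ._< i ℤ.+ j) (ℤₚ.+-identityʳ i) (ℤₚ.+-monoʳ-< i 0<j)

tr-delete-a : ∀ {N} → Positive N → tr N ℤ.< tr (cohn false · N)
tr-delete-a {mat p q s t} (positive p>0 q≥0 s≥0 t>0) = subst (p ℤ.+ t ℤ.<_) (identity p q s t)
  (i<i+j (p ℤ.+ t) (ℤₚ.+-mono-<-≤ (ℤₚ.+-mono-<-≤ p>0 s≥0) q≥0))
  where
  identity : ∀ p q s t →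
    (p ℤ.+ t) ℤ.+ (p ℤ.+ s ℤ.+ q) ≡ (+ 2 ℤ.* p ℤ.+ + 1 ℤ.* s) ℤ.+ (+ 1 ℤ.* q ℤ.+ + 1 ℤ.* t)
  identity = solve-∀

tr-lower-b : ∀ {N} → Positive N → tr (cohn false · N) ℤ.< tr (cohn true · N)
tr-lower-b {mat p q s t} (positive p>0 q≥0 s≥0 t>0) = subst (tr (cohn false · mat p q s t) ℤ.<_) (identity p q s t)
  (i<i+j (tr (cohn false · mat p q s t)) (ℤₚ.+-mono-<-≤ (ℤₚ.+-mono-<-≤ (scale-< 2 p>0) s≥0) q≥0))
  where
  identity : ∀ p q s t →
    ((+ 2 ℤ.* p ℤ.+ + 1 ℤ.* s) ℤ.+ (+ 1 ℤ.* q ℤ.+ + 1 ℤ.* t)) ℤ.+ (+ 3 ℤ.* p ℤ.+ s ℤ.+ q) ≡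
    (+ 5 ℤ.* p ℤ.+ + 2 ℤ.* s) ℤ.+ (+ 2 ℤ.* q ℤ.+ + 1 ℤ.* t)
  identity = solve-∀

-- The letter is rotated to the front, where deleting it is a comparison of N with A N for a
-- positive N.
trℕ-delete-a : ∀ α β → trℕ cohn (α ++ β) < trℕ cohn (α ++ false ∷ β)
trℕ-delete-a α β = subst₂ _<_ (trℕ-rotate cohn β α) (trℕ-rotate cohn (false ∷ β) α)
  (∣∣-mono-< (tr-positive N>0) (tr-delete-a N>0))
  where
  N>0 : Positive (ev cohn (β ++ α))
  N>0 = ev-cohn-positive (β ++ α)

trℕ-lower-b : ∀ α β → trℕ cohn (α ++ false ∷ β) < trℕ cohn (α ++ true ∷ β)
trℕ-lower-b α β = subst₂ _<_ (trℕ-rotate cohn (false ∷ β) α) (trℕ-rotate cohn (true ∷ β) α)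
  (∣∣-mono-< (tr-positive (cohn-positive false N>0)) (tr-lower-b N>0))
  where
  N>0 : Positive (ev cohn (β ++ α))
  N>0 = ev-cohn-positive (β ++ α)

find-a : ∀ w {n} → #a w ≡ suc n → ∃₂ λ α β → w ≡ α ++ false ∷ β
find-a (false ∷ w) _ = [] , w , refl
find-a (true ∷ w) eq with find-a w eq
... | α , β , refl = true ∷ α , β , refl

find-b : ∀ w {n} → #b w ≡ suc n → ∃₂ λ α β → w ≡ α ++ true ∷ β
find-b (true ∷ w) _ = [] , w , refl
find-b (false ∷ w) eq with find-b w eq
... | α , β , refl = false ∷ α , β , refl

-- `i` counts the deletions after the first; at least one takes place, so the drop is strict.
delete-a : ∀ i w n → #a w ≡ suc i + n → ∃ λ v → #a v ≡ n × #b v ≡ #b w × trℕ cohn v < trℕ cohn w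
delete-a i w n eq with find-a w eq
... | α , β , refl = continue i (ℕₚ.suc-injective (trans (sym (#a≡ shifted)) eq))
  where
  shifted : α ++ false ∷ β ∼ false ∷ α ++ β
  shifted = ↭⇒∼ (shift false α β)
  continue : ∀ i → #a (α ++ β) ≡ i + n →
    ∃ λ v → #a v ≡ n × #b v ≡ #b (α ++ false ∷ β) × trℕ cohn v < trℕ cohn (α ++ false ∷ β)
  continue zero    eq′ = α ++ β , eq′ , sym (#b≡ shifted) , trℕ-delete-a α β
  continue (suc i) eq′ with delete-a i (α ++ β) n eq′
  ... | v , va , vb , lt = v , va , trans vb (sym (#b≡ shifted)) , ℕₚ.<-trans lt (trℕ-delete-a α β)

-- Each b turned into a lowers the trace and keeps the length, so the letters a grow by the same
-- number.
lower-b : ∀ i w n → #b w ≡ suc i + n → ∃ λ v → #b v ≡ n × #a v ≡ suc i + #a w × trℕ cohn v < trℕ cohn w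
lower-b i w n eq with find-b w eq
... | α , β , refl = continue i (ℕₚ.suc-injective (trans (sym (#b≡ shifted)) eq))
  where
  shifted : α ++ true ∷ β ∼ true ∷ α ++ β
  shifted = ↭⇒∼ (shift true α β)
  lowered : α ++ false ∷ β ∼ false ∷ α ++ β
  lowered = ↭⇒∼ (shift false α β)
  a-count : #a (α ++ false ∷ β) ≡ suc (#a (α ++ true ∷ β))
  a-count = trans (#a≡ lowered) (cong suc (sym (#a≡ shifted)))
  continue : ∀ i → #b (α ++ β) ≡ i + n →
    ∃ λ v → #b v ≡ n × #a v ≡ suc i + #a (α ++ true ∷ β) × trℕ cohn v < trℕ cohn (α ++ true ∷ β)
  continue zero    eq′ = α ++ false ∷ β , trans (#b≡ lowered) eq′ , a-count , trℕ-lower-b α β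
  continue (suc i) eq′ with lower-b i (α ++ false ∷ β) n (trans (#b≡ lowered) eq′)
  ... | v , vb , va , lt = v , vb ,
    trans va (trans (cong (λ k → suc i + k) a-count) (ℕₚ.+-suc (suc i) _)) , ℕₚ.<-trans lt (trℕ-lower-b α β)

fixed-numerator : ∀ p q i {m m′} → IsMarkovIndex p q m → IsMarkovIndex p (q + suc i) m′ → m < m′
fixed-numerator p q i {m} {m′} I I′ with christoffel-of I | christoffel-of I′
... | s , b≡ , ab≡ , t≡ | s′ , b≡′ , ab≡′ , t≡′ with delete-a i (christoffel s′) (#a (christoffel s)) a≡
  where
  rearrange : ∀ x p i → x + p + suc i ≡ suc i + x + p
  rearrange = ℕ-Ring.solve-∀
  a≡ : #a (christoffel s′) ≡ suc i + #a (christoffel s)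
  a≡ = ℕₚ.+-cancelʳ-≡ p _ _ (trans ab≡′ (trans (cong (_+ suc i) (sym ab≡)) (rearrange (#a (christoffel s)) p i)))
-- `v` has the letters of the smaller index, so its trace lies between 3m and 3m′, strictly below
-- the latter.
... | v , va , vb , lt = ℕₚ.*-cancelˡ-< 3 m m′ (subst₂ _<_ t≡ t≡′
  (ℕₚ.≤-<-trans (christoffel-minimal s cohn-reversible v (va & trans vb (trans b≡′ (sym b≡)))) lt))

fixed-denominator : ∀ p q i {m m′} → IsMarkovIndex p q m → IsMarkovIndex (p + suc i) q m′ → m < m′
fixed-denominator p q i {m} {m′} I I′ with christoffel-of I | christoffel-of I′
... | s , b≡ , ab≡ , t≡ | s′ , b≡′ , ab≡′ , t≡′ with lower-b i (christoffel s′) p (trans b≡′ (ℕₚ.+-comm p (suc i)))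
... | v , vb , va , lt = ℕₚ.*-cancelˡ-< 3 m m′ (subst₂ _<_ t≡ t≡′
  (ℕₚ.≤-<-trans (christoffel-minimal s cohn-reversible v (trans va a≡ & trans vb (sym b≡))) lt))
  where
  rearrange : ∀ y p i → suc i + y + p ≡ y + (p + suc i)
  rearrange = ℕ-Ring.solve-∀
  -- The length is the fixed denominator, so the smaller index has exactly i + 1 more letters a.
  a≡ : suc i + #a (christoffel s′) ≡ #a (christoffel s)
  a≡ = ℕₚ.+-cancelʳ-≡ p _ _ (trans (rearrange (#a (christoffel s′)) p i) (trans ab≡′ (sym ab≡)))

theorem1p5 : ((p q i : ℕ) → 0 < p → 0 < i → p < q → gcd q p ≡ 1 → gcd (q + i) p ≡ 1 →
    (m m′ : ℕ) → IsMarkovIndex p q m → IsMarkovIndex p (q + i) m′ → m < m′)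
    ×
    ((p q i : ℕ) → 0 < p → 0 < i → p + i < q → gcd q p ≡ 1 → gcd q (p + i) ≡ 1 →
    (m m′ : ℕ) → IsMarkovIndex p q m → IsMarkovIndex (p + i) q m′ → m < m′)
theorem1p5 =
  -- Positivity of the shift leaves only the successor case, in which at least one letter is
  -- changed.
  (λ { p q (suc i) _ _ _ _ _ m m′ → fixed-numerator p q i }) ,
  (λ { p q (suc i) _ _ _ _ _ m m′ → fixed-denominator p q i })
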